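{- For every infinite cardinal $\kappa$, the random algebra $\mathcal{B}_\kappa$ does not specialize trees of height $\omega_1$ without cofinal branches; that is, if $T$ is a non-special tree of height $\omega_1$ without cofinal branches, then $T$ is non-special in the generic extension $V[\mathcal{B}_\kappa]$.
   Context: A tree $(T,<_T)$ of height $\omega_1$ is \emph{special} if there is a function $f:T\to\omega$ such that $s<_T t$ implies $f(s)\neq f(t)$. Trees may have arbitrary size. A cofinal branch is a chain meeting every level of $T$. \emph{Random algebra.} For infinite $\kappa$, let $\Sigma_\kappa$ be the $\sigma$-algebra on $2^\kappa$ generated by the cylinder sets $S_t=\{f\in 2^\kappa : t\subseteq f\}$, for $t$ a finite partial function from $\kappa$ to $2$; let $\lambda_\kappa$ be the product probability measure on $\Sigma_\kappa$, with $\lambda_\kappa(S_t)=2^{ -|t|}$; let $\mathscr{N}_\kappa$ be the ideal of $\lambda_\kappa$-null sets in $\Sigma_\kappa$. Then $\mathcal{B}_\kappa=\Sigma_\kappa/\mathscr{N}_\kappa$, a complete ccc Boolean algebra; as a forcing notion one uses its nonzero elements. -}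

module Defs where

open import Data.Bool using (Bool; true; false; not; _∧_)
import Data.Bool as Bool
open import Data.Bool.ListAction using (all)
open import Data.List using (List; []; length; map)
open import Data.List.Relation.Unary.Unique.Propositional using (Unique)
open import Data.List.Relation.Unary.AllPairs using ([])
open import Data.Nat using (ℕ; zero; suc)
open import Data.Product using (Σ; Σ-syntax; ∃; ∃-syntax; _×_; _,_; proj₁; proj₂)
open import Data.Rational using (ℚ; 0ℚ; 1ℚ; ½; _+_; _*_; _-_; -_; _<_; _<?_)
import Data.Rational.Properties as ℚ
open import Data.Sum using (_⊎_; inj₁; inj₂)
open import Data.Unit using (tt)
open import Function.Bundles using (_⇔_; Equivalence)
open import Induction.WellFounded using (WellFounded; Acc; acc)
open import Level using (Lift)
open import Relation.Binary.Definitions using (Transitive)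
open import Relation.Binary.PropositionalEquality using (_≡_; _≢_; refl; subst)
open import Relation.Nullary using (¬_; yes; no; contradiction)
open import Relation.Nullary.Decidable using (⌊_⌋; toWitnessFalse; toWitness)

-- The cumulative hierarchy over the universe Set: the class V of all
-- sets.  Under excluded middle it is a model of ZFC.

data V : Set₁ where
  sup : (I : Set) → (I → V) → V

infix 4 _≈_ _∈_

_≈_ : V → V → Set
sup I f ≈ sup J g =
  (∀ i → ∃[ j ] f i ≈ g j) × (∀ j → ∃[ i ] f i ≈ g j)

Index : V → Set
Index (sup I f) = I

_[_] : (x : V) → Index x → V
sup I f [ i ] = f i

_∈_ : V → V → Set
x ∈ y = ∃[ j ] x ≈ y [ j ]

｛_,_｝ : V → V → V
｛ x , y ｝ = sup Bool λ { true → x ; false → y }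

⟨_,_⟩ : V → V → V
⟨ x , y ⟩ = ｛ ｛ x , x ｝ , ｛ x , y ｝ ｝

TransitiveSet : V → Set₁
TransitiveSet x = ∀ y z → z ∈ y → y ∈ x → z ∈ x

-- ∈ is well-founded on V, so a transitive set of transitive sets is the
-- same as a transitive set well-ordered by ∈.

Ordinal : V → Set₁
Ordinal α = TransitiveSet α × (∀ β → β ∈ α → TransitiveSet β)

-- An element may have several indices; e may send them to different
-- numbers, but it separates distinct elements.

Countable : V → Set
Countable x = Σ[ e ∈ (Index x → ℕ) ] (∀ i j → e i ≡ e j → x [ i ] ≈ x [ j ])

-- T is the underlying set of a tree and R its order, a set of ordered pairs.

module _ (T R : V) where

  Below : V → V → Set
  Below s t = s ∈ T × t ∈ T × ⟨ s , t ⟩ ∈ R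

  Comparable : V → V → Set
  Comparable s t = Below s t ⊎ s ≈ t ⊎ Below t s

  -- A transitive well-founded relation is a strict partial order; with
  -- linearity the predecessors of each node are well-ordered.

  record IsTree : Set₁ where
    field
      transitive  : Transitive Below
      wellFounded : WellFounded Below
      linear      : ∀ t s s′ → Below s t → Below s′ t → Comparable s s′

module _ {T R : V} where

  -- ht t = { ht s : s <_T t }, which is the order type of the
  -- predecessors of t as a von Neumann ordinal.

  ht : ∀ t → Acc (Below T R) t → V
  ht t (acc rs) = sup (Σ[ i ∈ Index T ] Below T R (T [ i ]) t)
                      (λ (i , i<t) → ht (T [ i ]) (rs i<t))

  module _ (tree : IsTree T R) where
    open IsTree tree

    OnLevel : V → V → Set
    OnLevel α t = t ∈ T × ht t (wellFounded t) ≈ α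

    -- The ordinals of the nonempty levels; these are an initial segment
    -- of the ordinals, so this set is the least ordinal α such that
    -- level α is empty.

    height : V
    height = sup (Index T) (λ i → ht (T [ i ]) (wellFounded (T [ i ])))

    -- height = ω₁, where ω₁ is the set of all countable ordinals.

    HasHeightω₁ : Set₁
    HasHeightω₁ = ∀ α → α ∈ height ⇔ (Ordinal α × Countable α)

    record IsCofinalBranch (b : V) : Set₁ where
      field
        subset  : ∀ t → t ∈ b → t ∈ T
        chain   : ∀ s t → s ∈ b → t ∈ b → Comparable T R s t
        cofinal : ∀ α → α ∈ height → ∃[ t ] (t ∈ b × OnLevel α t)

    HasCofinalBranch : Set₁
    HasCofinalBranch = ∃[ b ] IsCofinalBranch b

-- Formulas of set theory with parameters from X (higher-order abstract
-- syntax for the quantifiers)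

infix  8 _∈′_ _≈′_
infix  7 ¬′_
infixr 6 _∧′_
infixr 5 _∨′_
infixr 4 _⇒′_
infix  3 ∀′_ ∃′_

data Formula {ℓ} (X : Set ℓ) : Set ℓ where
  _∈′_ _≈′_      : X → X → Formula X
  ¬′_            : Formula X → Formula X
  _∧′_ _∨′_ _⇒′_ : Formula X → Formula X → Formula X
  ∀′_ ∃′_        : (X → Formula X) → Formula X

module _ {ℓ} {X : Set ℓ} where

  infix 4 _⇔′_

  _⇔′_ : Formula X → Formula X → Formula X
  φ ⇔′ ψ = (φ ⇒′ ψ) ∧′ (ψ ⇒′ φ)

  -- u = {x , y}
  isUnorderedPair : X → X → X → Formula X
  isUnorderedPair u x y = ∀′ λ z → (z ∈′ u ⇔′ (z ≈′ x ∨′ z ≈′ y))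

  -- z = {{x , x} , {x , y}}
  isPair : X → X → X → Formula X
  isPair z x y = ∃′ λ a → ∃′ λ b →
    isUnorderedPair a x x ∧′ isUnorderedPair b x y ∧′ isUnorderedPair z a b

  -- ⟨ x , y ⟩ ∈ r
  related : X → X → X → Formula X
  related r x y = ∃′ λ z → (isPair z x y ∧′ z ∈′ r)

  isFunction : X → X → X → Formula X
  isFunction f A B =
       (∀′ λ z → z ∈′ f ⇒′
          (∃′ λ x → ∃′ λ y → x ∈′ A ∧′ y ∈′ B ∧′ isPair z x y))
    ∧′ (∀′ λ x → x ∈′ A ⇒′ (∃′ λ y → y ∈′ B ∧′ related f x y))
    ∧′ (∀′ λ x → ∀′ λ y → ∀′ λ y′ →
          related f x y ∧′ related f x y′ ⇒′ y ≈′ y′)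

  isEmpty : X → Formula X
  isEmpty e = ∀′ λ x → ¬′ (x ∈′ e)

  -- y = x ∪ {x}
  isSuccessor : X → X → Formula X
  isSuccessor y x = ∀′ λ z → (z ∈′ y ⇔′ (z ∈′ x ∨′ z ≈′ x))

  isInductive : X → Formula X
  isInductive w =
       (∃′ λ e → isEmpty e ∧′ e ∈′ w)
    ∧′ (∀′ λ x → x ∈′ w ⇒′ (∃′ λ y → isSuccessor y x ∧′ y ∈′ w))

  -- ω is the least inductive set.
  isω : X → Formula X
  isω w = isInductive w ∧′
    (∀′ λ v → isInductive v ⇒′ (∀′ λ x → x ∈′ w ⇒′ x ∈′ v))

  special : X → X → Formula X
  special T R = ∃′ λ w → ∃′ λ f → isω w ∧′ isFunction f T w ∧′
    (∀′ λ s → ∀′ λ t → s ∈′ T ∧′ t ∈′ T ∧′ related R s t ⇒′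
      (∀′ λ m → ∀′ λ n → related f s m ∧′ related f t n ⇒′ ¬′ (m ≈′ n)))

infix 2 ⊨_

⊨_ : Formula V → Set₁
⊨ (x ∈′ y) = Lift _ (x ∈ y)
⊨ (x ≈′ y) = Lift _ (x ≈ y)
⊨ (¬′ φ)   = ¬ (⊨ φ)
⊨ (φ ∧′ ψ) = (⊨ φ) × (⊨ ψ)
⊨ (φ ∨′ ψ) = (⊨ φ) ⊎ (⊨ ψ)
⊨ (φ ⇒′ ψ) = (⊨ φ) → (⊨ ψ)
⊨ (∀′ φ)   = ∀ x → ⊨ φ x
⊨ (∃′ φ)   = ∃[ x ] (⊨ φ x)

-- P is a preorder with greatest element 𝟙; no law is needed to define the
-- forcing relation.

module Forcing (P : Set) (_≤_ : P → P → Set) (𝟙 : P) where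

  -- name I x a is the name { (x i , a i) : i ∈ I }.

  data Name : Set₁ where
    name : (I : Set) → (I → Name) → (I → P) → Name

  infix 20 _ˇ

  _ˇ : V → Name
  sup I f ˇ = name I (λ i → f i ˇ) (λ _ → 𝟙)

  DenseBelow : ∀ {ℓ} → P → (P → Set ℓ) → Set ℓ
  DenseBelow p D = ∀ q → q ≤ p → ∃[ r ] (r ≤ q × D r)

  -- Two names are forced to be equal when each element of one is forced
  -- to be an element of the other.  The nested density conditions below
  -- are the clause for _⊩∈_,_ with its definition written out.

  _⊩≈_,_ : P → Name → Name → Set₁
  p ⊩≈ name I x a , name J y b =
      (∀ i q → q ≤ p → q ≤ a i →
         DenseBelow q λ r → ∃[ j ] (r ≤ b j × r ⊩≈ x i , y j))
    × (∀ j q → q ≤ p → q ≤ b j →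
         DenseBelow q λ r → ∃[ i ] (r ≤ a i × r ⊩≈ x i , y j))

  _⊩∈_,_ : P → Name → Name → Set₁
  p ⊩∈ x , name J y b = DenseBelow p λ r → ∃[ j ] (r ≤ b j × r ⊩≈ x , y j)

  infix 2 _⊩_

  _⊩_ : P → Formula Name → Set₁
  p ⊩ (x ∈′ y) = p ⊩∈ x , y
  p ⊩ (x ≈′ y) = p ⊩≈ x , y
  p ⊩ (¬′ φ)   = ∀ q → q ≤ p → ¬ (q ⊩ φ)
  p ⊩ (φ ∧′ ψ) = (p ⊩ φ) × (p ⊩ ψ)
  p ⊩ (φ ∨′ ψ) = DenseBelow p λ r → (r ⊩ φ) ⊎ (r ⊩ ψ)
  p ⊩ (φ ⇒′ ψ) = ∀ q → q ≤ p → q ⊩ φ → q ⊩ ψ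
  p ⊩ (∀′ φ)   = ∀ x → p ⊩ φ x
  p ⊩ (∃′ φ)   = DenseBelow p λ r → ∃[ x ] (r ⊩ φ x)

-- Real numbers, as (lower) Dedekind cuts.  They are the usual reals in
-- the presence of excluded middle.

record ℝ : Set₁ where
  field
    cut       : ℚ → Set
    inhabited : ∃[ q ] cut q
    bounded   : ∃[ q ] (¬ cut q)
    downward  : ∀ {q r} → q < r → cut r → cut q
    open′     : ∀ {q} → cut q → ∃[ r ] (q < r × cut r)

open ℝ

infix 4 _≃_ _≤ᴿ_

_≤ᴿ_ : ℝ → ℝ → Set
x ≤ᴿ y = ∀ q → cut x q → cut y q

_≃_ : ℝ → ℝ → Set
x ≃ y = ∀ q → cut x q ⇔ cut y q

private
  p-1<p : ∀ p → p - 1ℚ < p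
  p-1<p p = subst (p - 1ℚ <_) (ℚ.+-identityʳ p)
              (ℚ.+-monoʳ-< p { - 1ℚ} {0ℚ} (toWitness {a? = - 1ℚ <? 0ℚ} tt))

fromℚ : ℚ → ℝ
fromℚ p .cut q = q < p
fromℚ p .inhabited = p - 1ℚ , p-1<p p
fromℚ p .bounded = p , ℚ.<-irrefl refl
fromℚ p .downward = ℚ.<-trans
fromℚ p .open′ q<p with ℚ.<-dense q<p
... | r , q<r , r<p = r , q<r , r<p

0ᴿ : ℝ
0ᴿ = fromℚ 0ℚ

private
  below : ∀ x {a m} → cut x a → ¬ cut x m → a < m
  below x {a} {m} xa ¬xm with a <? m
  ... | yes a<m = a<m
  ... | no a≮m with m <? a
  ...   | yes m<a = contradiction (downward x m<a xa) ¬xm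
  ...   | no m≮a  = contradiction
    (subst (cut x) (ℚ.≤-antisym (ℚ.≮⇒≥ m≮a) (ℚ.≮⇒≥ a≮m)) xa) ¬xm

_+ᴿ_ : ℝ → ℝ → ℝ
(x +ᴿ y) .cut q = ∃[ a ] ∃[ b ] (cut x a × cut y b × q < a + b)
(x +ᴿ y) .inhabited with inhabited x | inhabited y
... | a , xa | b , yb = (a + b) - 1ℚ , a , b , xa , yb , p-1<p (a + b)
(x +ᴿ y) .bounded with bounded x | bounded y
... | m , ¬xm | n , ¬yn = m + n , λ (a , b , xa , yb , lt) →
  ℚ.<-asym lt (ℚ.+-mono-< (below x xa ¬xm) (below y yb ¬yn))
(x +ᴿ y) .downward q<r (a , b , xa , yb , lt) =
  a , b , xa , yb , ℚ.<-trans q<r lt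
(x +ᴿ y) .open′ (a , b , xa , yb , lt) with ℚ.<-dense lt
... | r , q<r , r<a+b = r , q<r , a , b , xa , yb , r<a+b

partialSum : (ℕ → ℝ) → ℕ → ℝ
partialSum a zero    = 0ᴿ
partialSum a (suc n) = partialSum a n +ᴿ a n

-- x is the sum of a series with nonnegative terms a n, that is, the
-- supremum of its partial sums; the supremum of cuts is their union.

IsSum : (ℕ → ℝ) → ℝ → Set
IsSum a x = ∀ q → cut x q ⇔ (∃[ n ] cut (partialSum a n) q)

½^_ : ℕ → ℚ
½^ zero  = 1ℚ
½^ suc n = ½ * ½^ n

module _ (K : Set) where

  2^ : Set
  2^ = K → Bool

  -- All subsets of 2^K, in the presence of excluded middle.

  Subset : Set
  Subset = 2^ → Bool

  -- A finite partial function from K to 2, given by its graph.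

  record FinPartial : Set where
    field
      graph      : List (K × Bool)
      functional : Unique (map proj₁ graph)

    size : ℕ
    size = length graph

open FinPartial

module _ {K : Set} where

  infix 4 _∋_ _≐_

  _∋_ : Subset K → 2^ K → Set
  A ∋ x = A x ≡ true

  _≐_ : Subset K → Subset K → Set
  A ≐ B = ∀ x → A x ≡ B x

  _∖_ : Subset K → Subset K → Subset K
  (A ∖ B) x = A x ∧ not (B x)

  ∁ : Subset K → Subset K
  ∁ A x = not (A x)

  Disjoint : (ℕ → Subset K) → Set
  Disjoint A = ∀ m n → m ≢ n → ∀ x → ¬ (A m ∋ x × A n ∋ x)

  IsUnion : (ℕ → Subset K) → Subset K → Set
  IsUnion A U = ∀ x → U ∋ x ⇔ (∃[ n ] A n ∋ x)

  ∅ : FinPartial K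
  ∅ .graph = []
  ∅ .functional = []

  cylinder : FinPartial K → Subset K
  cylinder t x = all (λ (k , b) → ⌊ x k Bool.≟ b ⌋) (graph t)

  -- The σ-algebra generated by the cylinders.  Subsets are Bool-valued,
  -- so a countable union is given by its characteristic property.

  data Measurable : Subset K → Set where
    cyl        : ∀ t → Measurable (cylinder t)
    complement : ∀ {A} → Measurable A → Measurable (∁ A)
    union      : ∀ {A U} → (∀ n → Measurable (A n)) → IsUnion A U → Measurable U

-- The product measure is the measure on the σ-algebra above taking the
-- value 2^(-|t|) on each cylinder S_t.

record ProductMeasure (K : Set) : Set₁ where
  field
    measure     : (A : Subset K) → Measurable A → ℝ
    congruence  : ∀ {A B} (a : Measurable A) (b : Measurable B) →
                  A ≐ B → measure A a ≃ measure B b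
    nonnegative : ∀ {A} (a : Measurable A) → 0ᴿ ≤ᴿ measure A a
    countablyAdditive :
      ∀ {A : ℕ → Subset K} {U} (a : ∀ n → Measurable (A n)) (u : Measurable U) →
      Disjoint A → IsUnion A U →
      IsSum (λ n → measure (A n) (a n)) (measure U u)
    onCylinders : ∀ t → measure (cylinder t) (cyl t) ≃ fromℚ (½^ size t)

module Random {K : Set} (μ : ProductMeasure K) where
  open ProductMeasure μ

  Null : Subset K → Set
  Null N = Σ[ m ∈ Measurable N ] measure N m ≃ 0ᴿ

  -- Nonzero elements of the quotient of the σ-algebra by the null ideal.
  -- A class is given by any of its representatives A, and [A] ≤ [B] in
  -- the quotient iff A ∖ B is null; so representatives of the same class
  -- are equivalent in this preorder.

  record Condition : Set where
    field
      set        : Subset K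
      measurable : Measurable set
      nonzero    : ¬ Null set

  open Condition

  _≤ᴮ_ : Condition → Condition → Set
  p ≤ᴮ q = Null (set p ∖ set q)

  𝟙 : Condition
  𝟙 .set = cylinder ∅
  𝟙 .measurable = cyl ∅
  𝟙 .nonzero (m , null) =
    toWitnessFalse {a? = ½ <? 0ℚ} tt
      (Equivalence.to (null ½)
        (Equivalence.to (congruence (cyl ∅) m (λ _ → refl) ½)
          (Equivalence.from (onCylinders ∅ ½)
            (toWitness {a? = ½ <? 1ℚ} tt))))

  open Forcing Condition _≤ᴮ_ 𝟙 public

module Submission where

-- Suppose p forces ḟ : Ť → ω to be injective on chains.  Put a node t into the class (n , k)
-- if some q ≤ p of measure greater than 1 / (k + 1) forces ḟ(t) = n.  Every node lies in
-- some class.  If s < t lie in the same class, then the witnessing conditions are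
-- incompatible, so their intersection is null; as the total measure is 1, a chain within
-- the class (n , k) has at most k elements.  Colouring a node by a class that contains it
-- and by the length of the longest chain of that class that ends in it specializes T.

open import Defs
open import Axiom.ExcludedMiddle using (ExcludedMiddle)
open import Data.Bool using (true; false; _∧_; _∨_)
import Data.Bool.Properties as Bool
open import Data.Empty using (⊥)
open import Data.Integer as ℤ using (-[1+_]) renaming (+_ to pos)
import Data.Integer.Properties as ℤ
open import Data.Maybe using (Maybe; just; nothing; maybe)
open import Data.Nat as ℕ using (ℕ; zero; suc; z≤n; s≤s)
import Data.Nat.Properties as ℕ
open import Data.Nat.Tactic.RingSolver using (solve-∀)
open import Data.Product using (Σ-syntax; ∃-syntax; _×_; _,_; proj₁; proj₂)
open import Data.Rational
  using (ℚ; mkℚ; 0ℚ; 1ℚ; _+_; _-_; -_; _<_; _≤_; _<?_; *<*; toℚᵘ; fromℚᵘ)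
import Data.Rational.Properties as ℚ
open import Data.Rational.Unnormalised as ℚᵘ using (mkℚᵘ; *≡*; *≤*)
import Data.Rational.Unnormalised.Properties as ℚᵘ
open import Data.Sum as Sum using (_⊎_; inj₁; inj₂)
open import Function.Base using (_∘_)
open import Function.Bundles using (_↣_; mk⇔; Equivalence)
open import Level using (Level; Lift; lift; lower)
open import Relation.Binary.Definitions using (tri<; tri≈; tri>)
open import Relation.Binary.PropositionalEquality
  using (_≡_; _≢_; refl; sym; trans; cong; subst)
open import Relation.Nullary using (¬_; Dec; yes; no; contradiction)
open import Relation.Nullary.Decidable using (decidable-stable)

-- An antichain in a ccc algebra is merely countable. A common positive lower bound on the measures
-- of its members makes it finite, with an explicit bound on its size. The thresholds 1 / (k + 1)
-- provide such a bound for every condition at the cost of only countably many classes. Three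
-- features of the setting shape the details. Elements of the algebra are sets modulo null sets, so
-- incompatible conditions are disjoint only up to a null set, and additivity is needed in that
-- weaker form. A node may have several indices in `T`, so classes and colours, which are attached
-- to indices, must be invariant under `≈`. Finally, `special` quantifies over a set satisfying
-- `isω`, so in the extension ω is given by an arbitrary name; its minimality against `ω ˇ` is what
-- allows values to be decided.

private variable
  ℓ : Level

-- Sets

≈-refl : ∀ x → x ≈ x
≈-refl (sup I f) = (λ i → i , ≈-refl (f i)) , (λ i → i , ≈-refl (f i))

≈-sym : ∀ x y → x ≈ y → y ≈ x
≈-sym (sup I f) (sup J g) (h , k) =
  (λ j → let i , e = k j in i , ≈-sym (f i) (g j) e) ,
  (λ i → let j , e = h i in j , ≈-sym (f i) (g j) e)

≈-trans : ∀ x y z → x ≈ y → y ≈ z → x ≈ z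
≈-trans (sup I f) (sup J g) (sup L h) (xy , yx) (yz , zy) =
  (λ i → let j , d = xy i ; l , e = yz j in l , ≈-trans (f i) (g j) (h l) d e) ,
  (λ l → let j , e = zy l ; i , d = yx j in i , ≈-trans (f i) (g j) (h l) d e)

∈-respˡ : ∀ x y z → x ≈ y → x ∈ z → y ∈ z
∈-respˡ x y z x≈y (j , x≈zj) = j , ≈-trans y x (z [ j ]) (≈-sym x y x≈y) x≈zj

∈-respʳ : ∀ x y z → y ≈ z → x ∈ y → x ∈ z
∈-respʳ x (sup J g) (sup L h) (yz , _) (j , x≈yj) =
  let l , e = yz j in l , ≈-trans x (g j) (h l) x≈yj e

[]∈ : ∀ x i → x [ i ] ∈ x
[]∈ x i = i , ≈-refl (x [ i ])

extensionality : ∀ x y → (∀ z → z ∈ x → z ∈ y) → (∀ z → z ∈ y → z ∈ x) → x ≈ y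
extensionality x@(sup I f) y@(sup J g) x⊆y y⊆x =
  (λ i → x⊆y (f i) ([]∈ x i)) ,
  (λ j → let i , e = y⊆x (g j) ([]∈ y j) in i , ≈-sym (g j) (f i) e)

-- Structural recursion: if `x ≈ f i`, then `f i ∈ x` turns into `f i ∈ f i` for the subterm `f i`.
∈-irrefl : ∀ x → ¬ (x ∈ x)
∈-irrefl x@(sup I f) (i , x≈fi) =
  ∈-irrefl (f i) (∈-respʳ (f i) x (f i) x≈fi ([]∈ x i))

｛｝-cong : ∀ x x′ y y′ → x ≈ x′ → y ≈ y′ → ｛ x , y ｝ ≈ ｛ x′ , y′ ｝
｛｝-cong x x′ y y′ x≈x′ y≈y′ =
  (λ { true → true , x≈x′ ; false → false , y≈y′ }) ,
  (λ { true → true , x≈x′ ; false → false , y≈y′ })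

⟨⟩-cong : ∀ x x′ y y′ → x ≈ x′ → y ≈ y′ → ⟨ x , y ⟩ ≈ ⟨ x′ , y′ ⟩
⟨⟩-cong x x′ y y′ x≈x′ y≈y′ =
  ｛｝-cong ｛ x , x ｝ ｛ x′ , x′ ｝ ｛ x , y ｝ ｛ x′ , y′ ｝
    (｛｝-cong x x′ x x′ x≈x′ x≈x′) (｛｝-cong x x′ y y′ x≈x′ y≈y′)

⟨⟩-injectiveˡ : ∀ x x′ y y′ → ⟨ x , y ⟩ ≈ ⟨ x′ , y′ ⟩ → x ≈ x′
⟨⟩-injectiveˡ x x′ y y′ (h , _) = fromEither (h true)
  where
  fromSingleton : ∃[ i ] (｛ x , x ｝ [ i ] ≈ x′) → x ≈ x′
  fromSingleton (true  , d) = d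
  fromSingleton (false , d) = d

  fromEither : ∃[ i ] (｛ x , x ｝ ≈ ⟨ x′ , y′ ⟩ [ i ]) → x ≈ x′
  fromEither (true  , e) = fromSingleton (proj₂ e true)
  fromEither (false , e) = fromSingleton (proj₂ e true)

-- Each second component occurs in the other pair, which gives the two alternatives of `second`. In
-- the crossed case `y ≈ x′` and `y′ ≈ x`, equality of the first components closes the gap.
⟨⟩-injectiveʳ : ∀ x x′ y y′ → ⟨ x , y ⟩ ≈ ⟨ x′ , y′ ⟩ → y ≈ y′
⟨⟩-injectiveʳ x x′ y y′ e =
  combine (second x x′ y y′ e) (second x′ x y′ y (≈-sym ⟨ x , y ⟩ ⟨ x′ , y′ ⟩ e))
  where
  second : ∀ x x′ y y′ → ⟨ x , y ⟩ ≈ ⟨ x′ , y′ ⟩ → y ≈ x′ ⊎ y ≈ y′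
  second x x′ y y′ (h , _) with h false
  ... | true , e with proj₁ e false
  ...   | true , d  = inj₁ d
  ...   | false , d = inj₁ d
  second x x′ y y′ (h , _) | false , e with proj₁ e false
  ...   | true , d  = inj₁ d
  ...   | false , d = inj₂ d

  combine : y ≈ x′ ⊎ y ≈ y′ → y′ ≈ x ⊎ y′ ≈ y → y ≈ y′
  combine (inj₂ y≈y′) _ = y≈y′
  combine (inj₁ _) (inj₂ y′≈y) = ≈-sym y′ y y′≈y
  combine (inj₁ y≈x′) (inj₁ y′≈x) =
    ≈-trans y x′ y′ y≈x′
      (≈-trans x′ x y′ (≈-sym x x′ (⟨⟩-injectiveˡ x x′ y y′ e)) (≈-sym y′ x y′≈x))

-- Numerals

succ : V → V
succ x = sup (Maybe (Index x)) (maybe (x [_]) x)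

∈-succ : ∀ x y → x ∈ succ y → x ∈ y ⊎ x ≈ y
∈-succ x y (just i , e) = inj₁ (i , e)
∈-succ x y (nothing , e) = inj₂ e

succ-∈ : ∀ x y → x ∈ y ⊎ x ≈ y → x ∈ succ y
succ-∈ x y (inj₁ (i , e)) = just i , e
succ-∈ x y (inj₂ e) = nothing , e

numeral : ℕ → V
numeral zero    = sup ⊥ λ ()
numeral (suc n) = succ (numeral n)

ω : V
ω = sup ℕ numeral

numeral-< : ∀ {m n} → m ℕ.< n → numeral m ∈ numeral n
numeral-< {m} {suc n} (s≤s m≤n) with ℕ.m≤n⇒m<n∨m≡n m≤n
... | inj₁ m<n  = succ-∈ (numeral m) (numeral n) (inj₁ (numeral-< m<n))
... | inj₂ refl = succ-∈ (numeral m) (numeral n) (inj₂ (≈-refl (numeral n)))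

numeral-injective : ∀ m n → numeral m ≈ numeral n → m ≡ n
numeral-injective m n e with ℕ.<-cmp m n
... | tri≈ _ m≡n _ = m≡n
... | tri< m<n _ _ = contradiction
  (∈-respˡ (numeral m) (numeral n) (numeral n) e (numeral-< m<n)) (∈-irrefl (numeral n))
... | tri> _ _ n<m = contradiction
  (∈-respʳ (numeral n) (numeral m) (numeral n) e (numeral-< n<m)) (∈-irrefl (numeral n))

numeral-cong : ∀ {m n} → m ≡ n → numeral m ≈ numeral n
numeral-cong {m} refl = ≈-refl (numeral m)

-- The meaning of the formulas in V

⊨isUnorderedPair : ∀ x y → ⊨ isUnorderedPair ｛ x , y ｝ x y
⊨isUnorderedPair x y z =
  (λ { (lift (true , e)) → inj₁ (lift e) ; (lift (false , e)) → inj₂ (lift e) }) ,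
  (λ { (inj₁ (lift e)) → lift (true , e) ; (inj₂ (lift e)) → lift (false , e) })

isUnorderedPair⇒≈ : ∀ u x y → ⊨ isUnorderedPair u x y → u ≈ ｛ x , y ｝
isUnorderedPair⇒≈ u x y h = extensionality u ｛ x , y ｝
  (λ z z∈u → lower (proj₂ (⊨isUnorderedPair x y z) (proj₁ (h z) (lift z∈u))))
  (λ z z∈p → lower (proj₂ (h z) (proj₁ (⊨isUnorderedPair x y z) (lift z∈p))))

⊨isPair : ∀ x y → ⊨ isPair ⟨ x , y ⟩ x y
⊨isPair x y = ｛ x , x ｝ , ｛ x , y ｝ ,
  ⊨isUnorderedPair x x , ⊨isUnorderedPair x y , ⊨isUnorderedPair ｛ x , x ｝ ｛ x , y ｝

isPair⇒≈ : ∀ z x y → ⊨ isPair z x y → z ≈ ⟨ x , y ⟩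
isPair⇒≈ z x y (a , b , ha , hb , hz) =
  ≈-trans z ｛ a , b ｝ ⟨ x , y ⟩ (isUnorderedPair⇒≈ z a b hz)
    (｛｝-cong a ｛ x , x ｝ b ｛ x , y ｝
      (isUnorderedPair⇒≈ a x x ha) (isUnorderedPair⇒≈ b x y hb))

⊨related : ∀ r x y → ⟨ x , y ⟩ ∈ r → ⊨ related r x y
⊨related r x y h = ⟨ x , y ⟩ , ⊨isPair x y , lift h

related⇒∈ : ∀ r x y → ⊨ related r x y → ⟨ x , y ⟩ ∈ r
related⇒∈ r x y (z , z-pair , lift z∈r) =
  ∈-respˡ z ⟨ x , y ⟩ r (isPair⇒≈ z x y z-pair) z∈r

⊨isω : ⊨ isω ω
⊨isω = ((numeral 0 , (λ { x (lift (() , _)) }) , lift ([]∈ ω 0)) , closed) , minimal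
  where
  closed : ∀ x → Lift _ (x ∈ ω) → ∃[ y ] (⊨ isSuccessor y x) × Lift _ (y ∈ ω)
  closed x (lift (n , x≈n)) = numeral (suc n) ,
    (λ z →
      (λ (lift h) → to z (∈-succ z (numeral n) h)) ,
      (λ h → lift (succ-∈ z (numeral n) (from z h)))) ,
    lift ([]∈ ω (suc n))
    where
    to : ∀ z → z ∈ numeral n ⊎ z ≈ numeral n → Lift _ (z ∈ x) ⊎ Lift _ (z ≈ x)
    to z (inj₁ h) = inj₁ (lift (∈-respʳ z (numeral n) x (≈-sym x (numeral n) x≈n) h))
    to z (inj₂ e) = inj₂ (lift (≈-trans z (numeral n) x e (≈-sym x (numeral n) x≈n)))

    from : ∀ z → Lift _ (z ∈ x) ⊎ Lift _ (z ≈ x) → z ∈ numeral n ⊎ z ≈ numeral n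
    from z (inj₁ (lift h)) = inj₁ (∈-respʳ z x (numeral n) x≈n h)
    from z (inj₂ (lift e)) = inj₂ (≈-trans z x (numeral n) e x≈n)

  module _ (v : V) (v-inductive : ⊨ isInductive v) where
    numeral∈ : ∀ n → numeral n ∈ v
    numeral∈ zero with proj₁ v-inductive
    ... | e , e-empty , lift e∈v = ∈-respˡ e (numeral 0) v
      (extensionality e (numeral 0) (λ z h → contradiction (lift h) (e-empty z)) λ { z (() , _) })
      e∈v
    numeral∈ (suc n) with proj₂ v-inductive (numeral n) (lift (numeral∈ n))
    ... | y , y-succ , lift y∈v = ∈-respˡ y (succ (numeral n)) v
      (extensionality y (succ (numeral n))
        (λ z h → succ-∈ z (numeral n) (Sum.map lower lower (proj₁ (y-succ z) (lift h))))
        (λ z h → lower (proj₂ (y-succ z) (Sum.map lift lift (∈-succ z (numeral n) h)))))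
      y∈v

  minimal : ∀ v → ⊨ isInductive v → ∀ x → Lift _ (x ∈ ω) → Lift _ (x ∈ v)
  minimal v v-inductive x (lift (n , x≈n)) =
    lift (∈-respˡ (numeral n) x v (≈-sym x (numeral n) x≈n) (numeral∈ v v-inductive n))

module _ {T R : V} where

  -- The witness is the graph of `c` as a set of pairs. Since one node may have several indices,
  -- this graph is functional only because `c` respects `≈`.
  colouring⇒special : (c : Index T → ℕ) →
    (∀ i j → T [ i ] ≈ T [ j ] → c i ≡ c j) →
    (∀ i j → ⟨ T [ i ] , T [ j ] ⟩ ∈ R → c i ≢ c j) →
    ⊨ special T R
  colouring⇒special c c-cong c-proper = ω , f , ⊨isω , (graph , total , functional) , proper
    where
    f : V
    f = sup (Index T) λ i → ⟨ T [ i ] , numeral (c i) ⟩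

    decode : ∀ x y → ⊨ related f x y → ∃[ i ] (x ≈ T [ i ] × y ≈ numeral (c i))
    decode x y h with related⇒∈ f x y h
    ... | i , e = i , ⟨⟩-injectiveˡ x (T [ i ]) y (numeral (c i)) e
                    , ⟨⟩-injectiveʳ x (T [ i ]) y (numeral (c i)) e

    graph : ⊨ (∀′ λ z → z ∈′ f ⇒′
                (∃′ λ x → ∃′ λ y → x ∈′ T ∧′ y ∈′ ω ∧′ isPair z x y))
    graph z (lift (i , z≈)) = T [ i ] , numeral (c i) ,
      lift ([]∈ T i) , lift ([]∈ ω (c i)) ,
      ｛ T [ i ] , T [ i ] ｝ , ｛ T [ i ] , numeral (c i) ｝ ,
      ⊨isUnorderedPair _ _ , ⊨isUnorderedPair _ _ ,
      λ u → (λ (lift u∈z) → proj₁ (⊨isUnorderedPair _ _ u) (lift (∈-respʳ u z _ z≈ u∈z))) ,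
            (λ h → lift (∈-respʳ u _ z (≈-sym z _ z≈) (lower (proj₂ (⊨isUnorderedPair _ _ u) h))))

    total : ⊨ (∀′ λ x → x ∈′ T ⇒′ (∃′ λ y → y ∈′ ω ∧′ related f x y))
    total x (lift (i , x≈)) = numeral (c i) , lift ([]∈ ω (c i)) ,
      ⊨related f x (numeral (c i))
        (i , ⟨⟩-cong x (T [ i ]) (numeral (c i)) (numeral (c i)) x≈ (≈-refl (numeral (c i))))

    functional : ⊨ (∀′ λ x → ∀′ λ y → ∀′ λ y′ →
                     related f x y ∧′ related f x y′ ⇒′ y ≈′ y′)
    functional x y y′ (h , h′) with decode x y h | decode x y′ h′
    ... | i , x≈i , y≈i | j , x≈j , y′≈j =
      lift (≈-trans y (numeral (c i)) y′ y≈i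
        (≈-trans (numeral (c i)) (numeral (c j)) y′
          (numeral-cong (c-cong i j (≈-trans (T [ i ]) x (T [ j ]) (≈-sym x (T [ i ]) x≈i) x≈j)))
          (≈-sym y′ (numeral (c j)) y′≈j)))

    proper : ⊨ (∀′ λ s → ∀′ λ t → s ∈′ T ∧′ t ∈′ T ∧′ related R s t ⇒′
                 (∀′ λ m → ∀′ λ n → related f s m ∧′ related f t n ⇒′ ¬′ (m ≈′ n)))
    proper s t (_ , _ , s<t) m n (hm , hn) (lift m≈n) with decode s m hm | decode t n hn
    ... | i , s≈i , m≈i | j , t≈j , n≈j = c-proper i j
      (∈-respˡ ⟨ s , t ⟩ ⟨ T [ i ] , T [ j ] ⟩ R
        (⟨⟩-cong s (T [ i ]) t (T [ j ]) s≈i t≈j) (related⇒∈ R s t s<t))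
      (numeral-injective (c i) (c j)
        (≈-trans (numeral (c i)) m (numeral (c j)) (≈-sym m (numeral (c i)) m≈i)
          (≈-trans m n (numeral (c j)) m≈n n≈j)))

-- Countable colourings

least : {P : ℕ → Set ℓ} → (∀ n → Dec (P n)) → ∀ n → P n →
        ∃[ m ] (P m × ∀ n → P n → m ℕ.≤ n)
least P? n Pn with P? 0
... | yes P0 = 0 , P0 , λ _ _ → z≤n
least P? zero P0     | no ¬P0 = contradiction P0 ¬P0
least P? (suc n) Pn  | no ¬P0 with least (P? ∘ suc) n Pn
... | m , Pm , m-least = suc m , Pm ,
  λ { zero P0 → contradiction P0 ¬P0 ; (suc k) Pk → s≤s (m-least k Pk) }

pair : ℕ × ℕ → ℕ
pair (a , b) = (a ℕ.+ b) ℕ.* (a ℕ.+ b) ℕ.+ a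

-- s² ≤ pair (a , b) < (s + 1)² for s = a + b.
pair-< : ∀ a b c d → a ℕ.+ b ℕ.< c ℕ.+ d → pair (a , b) ℕ.< pair (c , d)
pair-< a b c d s<t = begin-strict
  s ℕ.* s ℕ.+ a              ≤⟨ ℕ.+-monoʳ-≤ (s ℕ.* s) (ℕ.m≤m+n a b) ⟩
  s ℕ.* s ℕ.+ s              <⟨ s≤s (ℕ.m≤n+m _ s) ⟩
  suc s ℕ.+ (s ℕ.* s ℕ.+ s)  ≡⟨ square s ⟩
  suc s ℕ.* suc s            ≤⟨ ℕ.*-mono-≤ s<t s<t ⟩
  (c ℕ.+ d) ℕ.* (c ℕ.+ d)    ≤⟨ ℕ.m≤m+n _ c ⟩
  pair (c , d)               ∎
  where
  open ℕ.≤-Reasoning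
  s = a ℕ.+ b
  square : ∀ s → suc s ℕ.+ (s ℕ.* s ℕ.+ s) ≡ suc s ℕ.* suc s
  square = solve-∀

pair-injective : ∀ p q → pair p ≡ pair q → p ≡ q
pair-injective (a , b) (c , d) e with ℕ.<-cmp (a ℕ.+ b) (c ℕ.+ d)
... | tri< s<t _ _ = contradiction e (ℕ.<⇒≢ (pair-< a b c d s<t))
... | tri> _ _ t<s = contradiction (sym e) (ℕ.<⇒≢ (pair-< c d a b t<s))
... | tri≈ _ s≡t _ with ℕ.+-cancelˡ-≡ ((c ℕ.+ d) ℕ.* (c ℕ.+ d)) a c
                          (trans (cong (λ s → s ℕ.* s ℕ.+ a) (sym s≡t)) e)
... | refl = cong (a ,_) (ℕ.+-cancelˡ-≡ a b d s≡t)

module _ {I : Set} (_<_ : I → I → Set) (φ : I → Set ℓ) where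

  -- Chain n i: some chain in φ with n + 1 elements has i as its last element.
  Chain : ℕ → I → Set ℓ
  Chain zero    i = φ i
  Chain (suc n) i = φ i × ∃[ h ] (h < i × Chain n h)

module _ (em : ∀ {ℓ} → ExcludedMiddle ℓ) {I : Set} (_∼_ _<_ : I → I → Set)
         (∼-sym : ∀ {i j} → i ∼ j → j ∼ i)
         (<-resp-∼ : ∀ {h i j} → i ∼ j → h < i → h < j) where

  module _ {C : Set} (code : C → ℕ) (code-injective : ∀ c d → code c ≡ code d → c ≡ d)
           (φ : C → I → Set ℓ) (φ-resp-∼ : ∀ {c i j} → i ∼ j → φ c i → φ c j)
           (covered : ∀ i → ∃[ c ] φ c i)
           (short : ∀ c i → ∃[ n ] ¬ Chain _<_ (φ c) n i) where

    -- A class chosen by an arbitrary proof of covered could differ for ∼-equivalent i;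
    -- the class with the least code cannot.
    private
      leastClass : ∀ i → ∃[ n ] ((∃[ c ] (code c ≡ n × φ c i)) ×
                                 (∀ m → ∃[ c ] (code c ≡ m × φ c i) → n ℕ.≤ m))
      leastClass i = let c , h = covered i in least (λ _ → em) (code c) (c , refl , h)

      class : I → C
      class i = proj₁ (proj₁ (proj₂ (leastClass i)))

      class-φ : ∀ i → φ (class i) i
      class-φ i = proj₂ (proj₂ (proj₁ (proj₂ (leastClass i))))

      class-least : ∀ i c → φ c i → code (class i) ℕ.≤ code c
      class-least i c h with leastClass i
      ... | _ , (_ , refl , _) , minimal = minimal (code c) (c , refl , h)

      class-cong : ∀ {i j} → i ∼ j → class i ≡ class j
      class-cong {i} {j} i∼j = code-injective _ _ (ℕ.≤-antisym
        (class-least i (class j) (φ-resp-∼ (∼-sym i∼j) (class-φ j)))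
        (class-least j (class i) (φ-resp-∼ i∼j (class-φ i))))

      Chain-resp-∼ : ∀ {c} n {i j} → i ∼ j → Chain _<_ (φ c) n i → Chain _<_ (φ c) n j
      Chain-resp-∼ zero    i∼j h = φ-resp-∼ i∼j h
      Chain-resp-∼ (suc n) i∼j (h , g , g<i , k) = φ-resp-∼ i∼j h , g , <-resp-∼ i∼j g<i , k

      leastRank : ∀ c i → ∃[ n ] (¬ Chain _<_ (φ c) n i ×
                                  (∀ m → ¬ Chain _<_ (φ c) m i → n ℕ.≤ m))
      leastRank c i = let n , h = short c i in least (λ _ → em) n h

      -- `Chain n` has n + 1 elements, so the least `n` without such a chain is the number of
      -- elements of the longest chain ending in `i`; it is 0 when `i` is outside the class.
      rank : C → I → ℕ
      rank c i = proj₁ (leastRank c i)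

      rank-mono : ∀ c {i j} → i ∼ j → rank c i ℕ.≤ rank c j
      rank-mono c {i} {j} i∼j = proj₂ (proj₂ (leastRank c i)) (rank c j)
        λ h → proj₁ (proj₂ (leastRank c j)) (Chain-resp-∼ (rank c j) i∼j h)

      -- Any chain ending in `i` is extended by `j`. The rank of `j` is not 0, because `φ c j` is
      -- itself a chain with one element.
      rank-< : ∀ c {i j} → φ c j → i < j → rank c i ℕ.< rank c j
      rank-< c {i} {j} φj i<j with leastRank c j
      ... | zero  , ¬chain , _ = contradiction φj ¬chain
      ... | suc n , ¬chain , _ = s≤s (proj₂ (proj₂ (leastRank c i)) n
        λ h → ¬chain (φj , i , i<j , h))

      colour : I → ℕ
      colour i = pair (code (class i) , rank (class i) i)

    σ-boundedChains⇒colouring :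
      ∃[ c ] ((∀ i j → i ∼ j → c i ≡ c j) × (∀ i j → i < j → c i ≢ c j))
    σ-boundedChains⇒colouring = colour , colour-cong , colour-proper
      where
      colour-cong : ∀ i j → i ∼ j → colour i ≡ colour j
      colour-cong i j i∼j rewrite class-cong i∼j =
        cong (λ r → pair (code (class j) , r))
          (ℕ.≤-antisym (rank-mono (class j) i∼j) (rank-mono (class j) (∼-sym i∼j)))

      colour-proper : ∀ i j → i < j → colour i ≢ colour j
      colour-proper i j i<j e
        with pair-injective (code (class i) , rank (class i) i)
                            (code (class j) , rank (class j) j) e
      -- Equal colours mean equal classes, so both ranks can be taken in the class of `j`, where
      -- they differ.
      ... | e′ = ℕ.<⇒≢ (rank-< (class j) (class-φ j) i<j)
        (trans
          (cong (λ c → rank c i)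
            (sym (code-injective (class i) (class j) (cong proj₁ e′))))
          (cong proj₂ e′))

-- The forcing relation

module ForcingProperties
  (P : Set) (_≤_ : P → P → Set) (𝟙 : P)
  (≤-refl : ∀ {p} → p ≤ p) (≤-trans : ∀ {p q r} → p ≤ q → q ≤ r → p ≤ r)
  (≤-𝟙 : ∀ {p} → p ≤ 𝟙) where

  open Forcing P _≤_ 𝟙

  DenseBelow-mono : ∀ {p q} {D : P → Set ℓ} → q ≤ p → DenseBelow p D → DenseBelow q D
  DenseBelow-mono q≤p d r r≤q = d r (≤-trans r≤q q≤p)

  always : ∀ {p} {D : P → Set ℓ} → (∀ q → q ≤ p → D q) → DenseBelow p D
  always h q q≤p = q , ≤-refl , h q q≤p

  ⊩≈-refl : ∀ p x → p ⊩≈ x , x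
  ⊩≈-refl p (name I x a) =
    (λ i q q≤p q≤ai → always λ r r≤q → i , ≤-trans r≤q q≤ai , ⊩≈-refl r (x i)) ,
    (λ i q q≤p q≤ai → always λ r r≤q → i , ≤-trans r≤q q≤ai , ⊩≈-refl r (x i))

  ⊩≈-mono : ∀ {p q} x y → q ≤ p → p ⊩≈ x , y → q ⊩≈ x , y
  ⊩≈-mono (name I x a) (name J y b) q≤p (xy , yx) =
    (λ i r r≤q → xy i r (≤-trans r≤q q≤p)) ,
    (λ j r r≤q → yx j r (≤-trans r≤q q≤p))

  ⊩≈-sym : ∀ p x y → p ⊩≈ x , y → p ⊩≈ y , x
  ⊩≈-sym p (name I x a) (name J y b) (xy , yx) =
    (λ j q q≤p q≤bj r r≤q →
      let s , s≤r , i , s≤ai , e = yx j q q≤p q≤bj r r≤q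
      in s , s≤r , i , s≤ai , ⊩≈-sym s (x i) (y j) e) ,
    (λ i q q≤p q≤ai r r≤q →
      let s , s≤r , j , s≤bj , e = xy i q q≤p q≤ai r r≤q
      in s , s≤r , j , s≤bj , ⊩≈-sym s (x i) (y j) e)

  ⊩≈-trans : ∀ p x y z → p ⊩≈ x , y → p ⊩≈ y , z → p ⊩≈ x , z
  ⊩≈-trans p (name I x a) (name J y b) (name L z c) (xy , yx) (yz , zy) =
    (λ i q q≤p q≤ai r r≤q →
      let s , s≤r , j , s≤bj , d = xy i q q≤p q≤ai r r≤q
          u , u≤s , l , u≤cl , e =
            yz j s (≤-trans s≤r (≤-trans r≤q q≤p)) s≤bj s ≤-refl
      in u , ≤-trans u≤s s≤r , l , u≤cl ,
         ⊩≈-trans u (x i) (y j) (z l) (⊩≈-mono (x i) (y j) u≤s d) e) ,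
    (λ l q q≤p q≤cl r r≤q →
      let s , s≤r , j , s≤bj , e = zy l q q≤p q≤cl r r≤q
          u , u≤s , i , u≤ai , d =
            yx j s (≤-trans s≤r (≤-trans r≤q q≤p)) s≤bj s ≤-refl
      in u , ≤-trans u≤s s≤r , i , u≤ai ,
         ⊩≈-trans u (x i) (y j) (z l) d (⊩≈-mono (y j) (z l) u≤s e))

  ⊩∈-respˡ : ∀ p x y z → p ⊩≈ x , y → p ⊩∈ x , z → p ⊩∈ y , z
  ⊩∈-respˡ p x y (name L z c) x≈y x∈z q q≤p =
    let r , r≤q , l , r≤cl , e = x∈z q q≤p
    in r , r≤q , l , r≤cl ,
       ⊩≈-trans r y x (z l)
         (⊩≈-sym r x y (⊩≈-mono x y (≤-trans r≤q q≤p) x≈y)) e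

  ⊩∈-respʳ : ∀ p x y z → p ⊩≈ y , z → p ⊩∈ x , y → p ⊩∈ x , z
  ⊩∈-respʳ p x (name J y b) (name L z c) (yz , _) x∈y q q≤p =
    let r , r≤q , j , r≤bj , d = x∈y q q≤p
        s , s≤r , l , s≤cl , e = yz j r (≤-trans r≤q q≤p) r≤bj r ≤-refl
    in s , ≤-trans s≤r r≤q , l , s≤cl ,
       ⊩≈-trans s x (y j) (z l) (⊩≈-mono x (y j) s≤r d) e

  ⊩-mono : ∀ φ {p q} → q ≤ p → p ⊩ φ → q ⊩ φ
  ⊩-mono (x ∈′ name J y b) q≤p h         = DenseBelow-mono q≤p h
  ⊩-mono (x ≈′ y)          q≤p h         = ⊩≈-mono x y q≤p h
  ⊩-mono (¬′ φ)            q≤p h r r≤q   = h r (≤-trans r≤q q≤p)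
  ⊩-mono (φ ∧′ ψ)          q≤p (h , k)   = ⊩-mono φ q≤p h , ⊩-mono ψ q≤p k
  ⊩-mono (φ ∨′ ψ)          q≤p h         = DenseBelow-mono q≤p h
  ⊩-mono (φ ⇒′ ψ)          q≤p h r r≤q   = h r (≤-trans r≤q q≤p)
  ⊩-mono (∀′ φ)            q≤p h x       = ⊩-mono (φ x) q≤p (h x)
  ⊩-mono (∃′ φ)            q≤p h         = DenseBelow-mono q≤p h

  ˇ-≈ : ∀ p x y → x ≈ y → p ⊩≈ (x ˇ) , (y ˇ)
  ˇ-≈ p (sup I f) (sup J g) (fg , gf) =
    (λ i _ _ _ → always λ r _ → let j , e = fg i in j , ≤-𝟙 , ˇ-≈ r (f i) (g j) e) ,
    (λ j _ _ _ → always λ r _ → let i , e = gf j in i , ≤-𝟙 , ˇ-≈ r (f i) (g j) e)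

  ˇ-∈ : ∀ p x y → x ∈ y → p ⊩∈ (x ˇ) , (y ˇ)
  ˇ-∈ p x (sup J g) (j , e) = always λ r _ → j , ≤-𝟙 , ˇ-≈ r x (g j) e

  ⊩isUnorderedPairˇ : ∀ p x y → p ⊩ isUnorderedPair (｛ x , y ｝ ˇ) (x ˇ) (y ˇ)
  ⊩isUnorderedPairˇ p x y z = (λ q _ h r r≤q → to (h r r≤q)) , (λ q _ h r r≤q → from (h r r≤q))
    where
    to : ∀ {r} → ∃[ s ] (s ≤ r × ∃[ j ] (s ≤ 𝟙 × s ⊩≈ z , (｛ x , y ｝ [ j ] ˇ))) →
         ∃[ s ] (s ≤ r × ((s ⊩≈ z , (x ˇ)) ⊎ (s ⊩≈ z , (y ˇ))))
    to (s , s≤r , true  , _ , e) = s , s≤r , inj₁ e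
    to (s , s≤r , false , _ , e) = s , s≤r , inj₂ e

    from : ∀ {r} → ∃[ s ] (s ≤ r × ((s ⊩≈ z , (x ˇ)) ⊎ (s ⊩≈ z , (y ˇ)))) →
           ∃[ s ] (s ≤ r × ∃[ j ] (s ≤ 𝟙 × s ⊩≈ z , (｛ x , y ｝ [ j ] ˇ)))
    from (s , s≤r , inj₁ e) = s , s≤r , true  , ≤-𝟙 , e
    from (s , s≤r , inj₂ e) = s , s≤r , false , ≤-𝟙 , e

  ⊩relatedˇ : ∀ p r x y → ⟨ x , y ⟩ ∈ r → p ⊩ related (r ˇ) (x ˇ) (y ˇ)
  ⊩relatedˇ p r x y h = always λ q _ →
    ⟨ x , y ⟩ ˇ ,
    always (λ q _ → ｛ x , x ｝ ˇ , always λ q _ → ｛ x , y ｝ ˇ ,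
      ⊩isUnorderedPairˇ q x x , ⊩isUnorderedPairˇ q x y ,
      ⊩isUnorderedPairˇ q ｛ x , x ｝ ｛ x , y ｝) ,
    ˇ-∈ q ⟨ x , y ⟩ r h

  -- In `isInductive` the quantifier ranges over all names, so the predecessor is an arbitrary name
  -- `y` that is only forced to equal `x ˇ`.
  ⊩isSuccessorˇ : ∀ p x y → p ⊩≈ y , (x ˇ) → p ⊩ isSuccessor (succ x ˇ) y
  ⊩isSuccessorˇ p x@(sup I f) y y≈x z =
    (λ q q≤p h r r≤q → to (≤-trans r≤q q≤p) (h r r≤q)) ,
    (λ q q≤p h r r≤q → from (≤-trans r≤q q≤p) (h r r≤q))
    where
    to : ∀ {r} → r ≤ p →
         ∃[ s ] (s ≤ r × ∃[ j ] (s ≤ 𝟙 × s ⊩≈ z , (succ x [ j ] ˇ))) →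
         ∃[ s ] (s ≤ r × ((s ⊩∈ z , y) ⊎ (s ⊩≈ z , y)))
    to r≤p (s , s≤r , just i , _ , e) = s , s≤r , inj₁
      (⊩∈-respʳ s z (x ˇ) y
        (⊩≈-sym s y (x ˇ) (⊩≈-mono y (x ˇ) (≤-trans s≤r r≤p) y≈x))
        (always λ u u≤s → i , ≤-𝟙 , ⊩≈-mono z (f i ˇ) u≤s e))
    to r≤p (s , s≤r , nothing , _ , e) = s , s≤r , inj₂
      (⊩≈-trans s z (x ˇ) y e
        (⊩≈-sym s y (x ˇ) (⊩≈-mono y (x ˇ) (≤-trans s≤r r≤p) y≈x)))

    from : ∀ {r} → r ≤ p →
           ∃[ s ] (s ≤ r × ((s ⊩∈ z , y) ⊎ (s ⊩≈ z , y))) →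
           ∃[ s ] (s ≤ r × ∃[ j ] (s ≤ 𝟙 × s ⊩≈ z , (succ x [ j ] ˇ)))
    from r≤p (s , s≤r , inj₁ z∈y) =
      let u , u≤s , i , _ , e =
            ⊩∈-respʳ s z y (x ˇ) (⊩≈-mono y (x ˇ) (≤-trans s≤r r≤p) y≈x) z∈y s ≤-refl
      in u , ≤-trans u≤s s≤r , just i , ≤-𝟙 , e
    from r≤p (s , s≤r , inj₂ z≈y) = s , s≤r , nothing , ≤-𝟙 ,
      ⊩≈-trans s z y (x ˇ) z≈y (⊩≈-mono y (x ˇ) (≤-trans s≤r r≤p) y≈x)

  ⊩isInductiveˇ : ∀ p → p ⊩ isInductive (ω ˇ)
  ⊩isInductiveˇ p =
    always (λ q _ → numeral 0 ˇ ,
      (λ x r _ x∈0 → ¬∈0 (x∈0 r ≤-refl)) , ˇ-∈ q (numeral 0) ω ([]∈ ω 0)) ,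
    (λ x q _ x∈ω r r≤q →
      let s , s≤r , n , _ , e = x∈ω r r≤q
      in s , s≤r , numeral (suc n) ˇ ,
         ⊩isSuccessorˇ s (numeral n) x e , ˇ-∈ s (numeral (suc n)) ω ([]∈ ω (suc n)))
    where
    ¬∈0 : ∀ {p x} → ¬ (∃[ r ] (r ≤ p × ∃[ j ] (r ≤ 𝟙 × r ⊩≈ x , (numeral 0 [ j ] ˇ))))
    ¬∈0 (_ , _ , () , _)

  -- `ω ˇ` is forced to be inductive, so the minimality of `w` puts `y` into `ω ˇ`; the density in
  -- the definition of forced membership then supplies an index of `ω`, which is a natural number.
  ⊩∈ω⇒numeral : ∀ {p} w y → p ⊩ isω w → p ⊩∈ y , w →
                ∃[ q ] (q ≤ p × ∃[ n ] q ⊩≈ y , (numeral n ˇ))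
  ⊩∈ω⇒numeral {p} w y (_ , w-least) y∈w =
    let q , q≤p , n , _ , e =
          w-least (ω ˇ) p ≤-refl (⊩isInductiveˇ p) y p ≤-refl y∈w p ≤-refl
    in q , q≤p , n , e

  module Specializing (T R : V) (p : P) (w f : Name)
    (p⊩ω : p ⊩ isω w) (p⊩f : p ⊩ isFunction f (T ˇ) w)
    (p⊩special : p ⊩ (∀′ λ s → ∀′ λ t → s ∈′ T ˇ ∧′ t ∈′ T ˇ ∧′ related (R ˇ) s t ⇒′
      (∀′ λ m → ∀′ λ n → related f s m ∧′ related f t n ⇒′ ¬′ (m ≈′ n)))) where

    -- The value is a name `y` together with a forced equality to a numeral, matching the form in
    -- which `p⊩special` takes the values of `f`.
    Decides : Index T → ℕ → P → Set₁
    Decides i n q = q ≤ p × ∃[ y ] ((q ⊩ related f (T [ i ] ˇ) y) × q ⊩≈ y , (numeral n ˇ))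

    decided : ∀ i → ∃[ n ] ∃[ q ] Decides i n q
    decided i =
      let q , q≤p , y , y∈w , fy =
            proj₁ (proj₂ p⊩f) (T [ i ] ˇ) p ≤-refl (ˇ-∈ p (T [ i ]) T ([]∈ T i)) p ≤-refl
          r , r≤q , n , e = ⊩∈ω⇒numeral w y (⊩-mono (isω w) q≤p p⊩ω) y∈w
      in n , r , ≤-trans r≤q q≤p , y , ⊩-mono (related f (T [ i ] ˇ) y) r≤q fy , e

    -- A common extension `s` would force both values to equal `numeral n ˇ`, and hence each other,
    -- against injectivity on chains.
    decides-incompatible : ∀ {i j n q r} → ⟨ T [ i ] , T [ j ] ⟩ ∈ R →
      Decides i n q → Decides j n r → ∀ s → s ≤ q → ¬ (s ≤ r)
    decides-incompatible {i} {j} {n} i<j (q≤p , y , fy , y≈n) (r≤p , z , fz , z≈n) s s≤q s≤r =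
      p⊩special (T [ i ] ˇ) (T [ j ] ˇ) s (≤-trans s≤q q≤p)
        (ˇ-∈ s (T [ i ]) T ([]∈ T i) , ˇ-∈ s (T [ j ]) T ([]∈ T j) ,
          ⊩relatedˇ s R (T [ i ]) (T [ j ]) i<j)
        y z s ≤-refl
        (⊩-mono (related f (T [ i ] ˇ) y) s≤q fy , ⊩-mono (related f (T [ j ] ˇ) z) s≤r fz)
        s ≤-refl
        (⊩≈-trans s y (numeral n ˇ) z (⊩≈-mono y (numeral n ˇ) s≤q y≈n)
          (⊩≈-sym s z (numeral n ˇ) (⊩≈-mono z (numeral n ˇ) s≤r z≈n)))

-- Rational and real numbers

open ℝ
open Equivalence

-- n / (k + 1)
frac : ℕ → ℕ → ℚ
frac n k = fromℚᵘ (mkℚᵘ (pos n) k)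

-- Normalisation hides the common denominator, so the computation is made with unnormalised
-- fractions, where the sum has denominator (k + 1)² and one factor cancels.
frac-+ : ∀ m n k → frac m k + frac n k ≡ frac (m ℕ.+ n) k
frac-+ m n k = ℚ.toℚᵘ-injective (begin
  toℚᵘ (frac m k + frac n k)            ≈⟨ ℚ.toℚᵘ-homo-+ (frac m k) (frac n k) ⟩
  toℚᵘ (frac m k) ℚᵘ.+ toℚᵘ (frac n k)  ≈⟨ ℚᵘ.+-cong (ℚ.toℚᵘ-fromℚᵘ (mkℚᵘ (pos m) k))
                                                      (ℚ.toℚᵘ-fromℚᵘ (mkℚᵘ (pos n) k)) ⟩
  mkℚᵘ (pos m) k ℚᵘ.+ mkℚᵘ (pos n) k    ≈⟨ *≡* same ⟩
  mkℚᵘ (pos (m ℕ.+ n)) k                ≈⟨ ℚ.toℚᵘ-fromℚᵘ (mkℚᵘ (pos (m ℕ.+ n)) k) ⟨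
  toℚᵘ (frac (m ℕ.+ n) k)               ∎)
  where
  open ℚᵘ.≃-Reasoning
  d = suc k
  same : (pos m ℤ.* pos d ℤ.+ pos n ℤ.* pos d) ℤ.* pos d ≡ pos (m ℕ.+ n) ℤ.* pos (d ℕ.* d)
  same = trans (cong (ℤ._* pos d) (sym (ℤ.*-distribʳ-+ (pos d) (pos m) (pos n))))
           (trans (ℤ.*-assoc (pos m ℤ.+ pos n) (pos d) (pos d))
                  (cong ((pos m ℤ.+ pos n) ℤ.*_) (sym (ℤ.pos-* d d))))

frac-1 : ∀ k → frac (suc k) k ≡ 1ℚ
frac-1 k = ℚ.toℚᵘ-injective
  (ℚᵘ.≃-trans (ℚ.toℚᵘ-fromℚᵘ (mkℚᵘ (pos (suc k)) k)) (*≡* (ℤ.*-comm (pos (suc k)) (pos 1))))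

-- A positive fraction has numerator at least 1, so its own denominator serves as k + 1.
archimedean : ∀ q → 0ℚ < q → ∃[ k ] frac 1 k ≤ q
archimedean (mkℚ (pos (suc a)) d c) _ = d , ℚ.toℚᵘ-cancel-≤
  (ℚᵘ.≤-respˡ-≃ (ℚᵘ.≃-sym (ℚ.toℚᵘ-fromℚᵘ (mkℚᵘ (pos 1) d)))
    (*≤* (ℤ.*-monoʳ-≤-nonNeg (pos (suc d)) {pos 1} {pos (suc a)} (ℤ.+≤+ (s≤s z≤n)))))
archimedean (mkℚ (pos zero) d c) (*<* (ℤ.+<+ ()))
archimedean (mkℚ -[1+ a ] d c) (*<* ())

p-q+q≡p : ∀ p q → (p - q) + q ≡ p
p-q+q≡p p q = trans (ℚ.+-assoc p (- q) q)
  (trans (cong (p +_) (ℚ.+-inverseˡ q)) (ℚ.+-identityʳ p))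

p-q<r : ∀ {p q r} → p < r + q → p - q < r
p-q<r {p} {q} {r} p<r+q = subst (p - q <_)
  (trans (ℚ.+-assoc r q (- q)) (trans (cong (_+_ r) (ℚ.+-inverseʳ q)) (ℚ.+-identityʳ r)))
  (ℚ.+-monoˡ-< (- q) p<r+q)

≤ᴿ-trans : ∀ x y z → x ≤ᴿ y → y ≤ᴿ z → x ≤ᴿ z
≤ᴿ-trans x y z x≤y y≤z q xq = y≤z q (x≤y q xq)

+ᴿ-mono : ∀ x x′ y y′ → x ≤ᴿ x′ → y ≤ᴿ y′ → (x +ᴿ y) ≤ᴿ (x′ +ᴿ y′)
+ᴿ-mono x x′ y y′ x≤ y≤ q (a , b , xa , yb , lt) = a , b , x≤ a xa , y≤ b yb , lt

+ᴿ-comm : ∀ x y → (x +ᴿ y) ≤ᴿ (y +ᴿ x)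
+ᴿ-comm x y q (a , b , xa , yb , lt) = b , a , yb , xa , subst (q <_) (ℚ.+-comm a b) lt

x+y≤x : ∀ x y → y ≤ᴿ 0ᴿ → (x +ᴿ y) ≤ᴿ x
x+y≤x x y y≤0 q (a , b , xa , yb , q<a+b) = downward x
  (ℚ.<-trans q<a+b (subst (a + b <_) (ℚ.+-identityʳ a) (ℚ.+-monoʳ-< a (y≤0 b yb)))) xa

-- The rational 0 is not in the cut `0ᴿ`, so some room is needed: for `r` in `x` above `q` and `m`
-- strictly between them, the negative number `m - r` lies in `y`, and adding it to `r` still
-- exceeds `q`.
x≤x+y : ∀ x y → 0ᴿ ≤ᴿ y → x ≤ᴿ (x +ᴿ y)
x≤x+y x y 0≤y q xq =
  let r , q<r , xr = open′ x xq
      m , q<m , m<r = ℚ.<-dense q<r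
  in r , m - r , xr , 0≤y (m - r) (p-q<r (subst (m <_) (sym (ℚ.+-identityˡ r)) m<r)) ,
     subst (q <_) (trans (sym (p-q+q≡p m r)) (ℚ.+-comm (m - r) r)) q<m

cut-+ : ∀ x y {a b} → cut x a → cut y b → cut (x +ᴿ y) (a + b)
cut-+ x y {a} {b} xa yb =
  let a′ , a<a′ , xa′ = open′ x xa in a′ , b , xa′ , yb , ℚ.+-monoˡ-< b a<a′

noPositive⇒≤0 : ∀ x → (∀ q → 0ℚ < q → ¬ cut x q) → x ≤ᴿ 0ᴿ
noPositive⇒≤0 x h q xq with q <? 0ℚ
... | yes q<0 = q<0
... | no q≮0 = let r , q<r , xr = open′ x xq in
  contradiction xr (h r (ℚ.≤-<-trans (ℚ.≮⇒≥ q≮0) q<r))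

-- Measurable sets

module _ {K : Set} where

  infixr 7 _∩_
  infixr 6 _∪_

  _∪_ _∩_ : Subset K → Subset K → Subset K
  (A ∪ B) x = A x ∨ B x
  (A ∩ B) x = A x ∧ B x

  -- `union` describes its result only by its elements, so a constant sequence yields any set with
  -- the same elements.
  Measurable-resp-≐ : ∀ {A B : Subset K} → A ≐ B → Measurable A → Measurable B
  Measurable-resp-≐ A≐B a = union (λ _ → a) λ x →
    mk⇔ (λ x∈B → 0 , trans (A≐B x) x∈B) (λ (_ , x∈A) → trans (sym (A≐B x)) x∈A)

  Measurable-∪ : ∀ {A B : Subset K} → Measurable A → Measurable B → Measurable (A ∪ B)
  Measurable-∪ {A} {B} a b = union {A = A,B} (λ { zero → a ; (suc _) → b }) λ x →
    mk⇔ (to′ x) (from′ x)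
    where
    A,B : ℕ → Subset K
    A,B zero    = A
    A,B (suc _) = B

    to′ : ∀ x → (A ∪ B) ∋ x → ∃[ n ] A,B n ∋ x
    to′ x h with A x in eq
    ... | true  = 0 , eq
    ... | false = 1 , h

    from′ : ∀ x → ∃[ n ] A,B n ∋ x → (A ∪ B) ∋ x
    from′ x (zero  , h) rewrite h = refl
    from′ x (suc _ , h) rewrite h = Bool.∨-zeroʳ (A x)

  Measurable-∩ : ∀ {A B : Subset K} → Measurable A → Measurable B → Measurable (A ∩ B)
  Measurable-∩ {A} {B} a b = Measurable-resp-≐ deMorgan
    (complement (Measurable-∪ (complement a) (complement b)))
    where
    deMorgan : ∁ (∁ A ∪ ∁ B) ≐ (A ∩ B)
    deMorgan x with A x
    ... | true  = Bool.not-involutive (B x)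
    ... | false = refl

  Measurable-∖ : ∀ {A B : Subset K} → Measurable A → Measurable B → Measurable (A ∖ B)
  Measurable-∖ a b = Measurable-∩ a (complement b)

  ∖⊆ : ∀ (A B : Subset K) x → (A ∖ B) ∋ x → A ∋ x
  ∖⊆ A B x h with A x
  ... | true = refl

  ∖-disjoint : ∀ (A B : Subset K) x → (A ∖ B) ∋ x → ¬ B ∋ x
  ∖-disjoint A B x h x∈B rewrite x∈B with trans (sym h) (Bool.∧-zeroʳ (A x))
  ... | ()

  ∩⊆ˡ : ∀ (A B : Subset K) x → (A ∩ B) ∋ x → A ∋ x
  ∩⊆ˡ A B x h with A x
  ... | true = refl

  ∩⊆ʳ : ∀ (A B : Subset K) x → (A ∩ B) ∋ x → B ∋ x
  ∩⊆ʳ A B x h with A x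
  ... | true = h

  ∖-∪-∩ : ∀ (A B : Subset K) → A ≐ ((A ∖ B) ∪ (A ∩ B))
  ∖-∪-∩ A B x with A x | B x
  ... | true  | true  = refl
  ... | true  | false = refl
  ... | false | _     = refl

-- Finite additivity and null sets

module MeasureProperties {K : Set} (μ : ProductMeasure K) where
  open ProductMeasure μ
  open Random μ using (Null)

  private
    full empty : Subset K
    full  = cylinder ∅
    empty = ∁ full

    empty-measurable : Measurable empty
    empty-measurable = complement (cyl ∅)

  module _ {A B : Subset K} (a : Measurable A) (b : Measurable B) where

    private
      sets : ℕ → Subset K
      sets 0             = A
      sets 1             = B
      sets (suc (suc _)) = empty

      sets-measurable : ∀ n → Measurable (sets n)
      sets-measurable 0             = a
      sets-measurable 1             = b
      sets-measurable (suc (suc _)) = empty-measurable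

      sets-disjoint : (∀ x → A ∋ x → ¬ B ∋ x) → Disjoint sets
      sets-disjoint A∩B 0 0 0≢0 x _ = 0≢0 refl
      sets-disjoint A∩B 0 1 _ x (x∈A , x∈B) = A∩B x x∈A x∈B
      sets-disjoint A∩B 1 0 _ x (x∈B , x∈A) = A∩B x x∈A x∈B
      sets-disjoint A∩B 1 1 1≢1 x _ = 1≢1 refl
      sets-disjoint A∩B (suc (suc _)) _ _ x (() , _)
      sets-disjoint A∩B 0 (suc (suc _)) _ x (_ , ())
      sets-disjoint A∩B 1 (suc (suc _)) _ x (_ , ())

      sets-union : ∀ {U} → U ≐ (A ∪ B) → IsUnion sets U
      sets-union U≐ x = mk⇔ (λ x∈U → to′ (trans (sym (U≐ x)) x∈U)) (λ h → trans (U≐ x) (from′ h))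
        where
        to′ : (A ∪ B) ∋ x → ∃[ n ] sets n ∋ x
        to′ h with A x in eq
        ... | true  = 0 , eq
        ... | false = 1 , h

        from′ : ∃[ n ] sets n ∋ x → (A ∪ B) ∋ x
        from′ (0 , h) rewrite h = refl
        from′ (1 , h) rewrite h = Bool.∨-zeroʳ (A x)
        from′ (suc (suc _) , ())

    -- The partial sums of the padded sequence lie below its sum whatever the measure of `empty` is,
    -- so this half is available for proving `measure-empty`.
    superadditive : ∀ {U} (u : Measurable U) → (∀ x → A ∋ x → ¬ B ∋ x) → U ≐ (A ∪ B) →
      (measure A a +ᴿ measure B b) ≤ᴿ measure U u
    superadditive u A∩B U≐ q h =
      -- The second partial sum is (0 + μ(A)) + μ(B).
      from (countablyAdditive sets-measurable u (sets-disjoint A∩B) (sets-union U≐) q) (2 ,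
        +ᴿ-mono (measure A a) (0ᴿ +ᴿ measure A a) (measure B b) (measure B b)
          (≤ᴿ-trans (measure A a) (measure A a +ᴿ 0ᴿ) (0ᴿ +ᴿ measure A a)
            (x≤x+y (measure A a) 0ᴿ λ _ lt → lt) (+ᴿ-comm (measure A a) 0ᴿ))
          (λ _ lt → lt) q h)

    -- Beyond the second term every summand is the measure of `empty`. That it is at most 0 is an
    -- assumption here, discharged in `subadditive` once `superadditive` has yielded
    -- `measure-empty`.
    additive-≤ : ∀ {U} (u : Measurable U) → (∀ x → A ∋ x → ¬ B ∋ x) → U ≐ (A ∪ B) →
      measure empty empty-measurable ≤ᴿ 0ᴿ → measure U u ≤ᴿ (measure A a +ᴿ measure B b)
    additive-≤ u A∩B U≐ empty≤0 q h =
      let n , k = to (countablyAdditive sets-measurable u (sets-disjoint A∩B) (sets-union U≐) q) h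
      in bound n q k
      where
      term = λ n → measure (sets n) (sets-measurable n)
      sum  = measure A a +ᴿ measure B b

      bound : ∀ n → partialSum term n ≤ᴿ sum
      bound 0 = ≤ᴿ-trans 0ᴿ (measure A a) sum (nonnegative a)
        (x≤x+y (measure A a) (measure B b) (nonnegative b))
      bound 1 q h = x≤x+y (measure A a) (measure B b) (nonnegative b) q
        (x+y≤x (measure A a) 0ᴿ (λ _ lt → lt) q (+ᴿ-comm 0ᴿ (measure A a) q h))
      bound 2 = +ᴿ-mono (0ᴿ +ᴿ measure A a) (measure A a) (measure B b) (measure B b)
        (λ q h → x+y≤x (measure A a) 0ᴿ (λ _ lt → lt) q (+ᴿ-comm 0ᴿ (measure A a) q h))
        (λ _ lt → lt)
      bound (suc (suc (suc n))) q (c , d , sc , ed , lt) =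
        bound (suc (suc n)) q
          (x+y≤x (partialSum term (suc (suc n))) (measure empty empty-measurable) empty≤0 q
            (c , d , sc , ed , lt))

  -- full is the union of full and empty, so 1 + μ(empty) ≤ 1.
  measure-empty : measure empty empty-measurable ≤ᴿ 0ᴿ
  measure-empty = noPositive⇒≤0 (measure empty empty-measurable) λ q 0<q hq →
    ℚ.<-irrefl (p-q+q≡p 1ℚ q)
      (to (onCylinders ∅ ((1ℚ - q) + q))
        (superadditive (cyl ∅) empty-measurable (cyl ∅) (λ _ _ ()) (λ _ → refl) ((1ℚ - q) + q)
          (cut-+ (measure full (cyl ∅)) (measure empty empty-measurable)
            (from (onCylinders ∅ (1ℚ - q))
              (p-q<r {1ℚ} {q} {1ℚ} (subst (_< 1ℚ + q) (ℚ.+-identityʳ 1ℚ) (ℚ.+-monoʳ-< 1ℚ 0<q))))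
            hq)))

  subadditive : ∀ {A B U} (a : Measurable A) (b : Measurable B) (u : Measurable U) →
    (∀ x → A ∋ x → ¬ B ∋ x) → U ≐ (A ∪ B) → measure U u ≤ᴿ (measure A a +ᴿ measure B b)
  subadditive a b u A∩B U≐ = additive-≤ a b u A∩B U≐ measure-empty

  measure-mono : ∀ {A B} (a : Measurable A) (b : Measurable B) →
                 (∀ x → A ∋ x → B ∋ x) → measure A a ≤ᴿ measure B b
  measure-mono {A} {B} a b A⊆B q h =
    superadditive a b∖a b (λ x x∈A h → ∖-disjoint B A x h x∈A) cover q
      (x≤x+y (measure A a) (measure (B ∖ A) b∖a) (nonnegative b∖a) q h)
    where
    b∖a : Measurable (B ∖ A)
    b∖a = Measurable-∖ b a

    cover : B ≐ (A ∪ (B ∖ A))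
    cover x with A x in eq
    ... | true  = A⊆B x eq
    ... | false = sym (Bool.∧-identityʳ (B x))

  -- `Null` carries its own proof of measurability; `congruence` transfers the value to any other
  -- one.
  Null⇒≤0 : ∀ {A} (a : Measurable A) → Null A → measure A a ≤ᴿ 0ᴿ
  Null⇒≤0 a (m , m≃0) q h = to (m≃0 q) (to (congruence a m (λ _ → refl) q) h)

  ≤0⇒Null : ∀ {A} (a : Measurable A) → measure A a ≤ᴿ 0ᴿ → Null A
  ≤0⇒Null a a≤0 = a , λ q → mk⇔ (a≤0 q) (nonnegative a q)

  Null-⊆ : ∀ {A B} → Measurable A → (∀ x → A ∋ x → B ∋ x) → Null B → Null A
  Null-⊆ a A⊆B B-null@(b , _) = ≤0⇒Null a
    λ q h → Null⇒≤0 b B-null q (measure-mono a b A⊆B q h)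

  Null-empty : ∀ {A} → Measurable A → (∀ x → ¬ A ∋ x) → Null A
  Null-empty a ∉A = Null-⊆ a (λ x x∈A → contradiction x∈A (∉A x))
    (≤0⇒Null empty-measurable measure-empty)

  ⊆⇒Null-∖ : ∀ {A B} → Measurable A → Measurable B → (∀ x → A ∋ x → B ∋ x) → Null (A ∖ B)
  ⊆⇒Null-∖ {A} {B} a b A⊆B = Null-empty (Measurable-∖ a b)
    λ x h → ∖-disjoint A B x h (A⊆B x (∖⊆ A B x h))

  Null-∪ : ∀ {A B} → Null A → Null B → Null (A ∪ B)
  Null-∪ {A} {B} A-null@(a , _) B-null@(b , _) = ≤0⇒Null (Measurable-∪ a b) λ q h →
    Null⇒≤0 a A-null q
      (x+y≤x (measure A a) (measure (B ∖ A) b∖a) (Null⇒≤0 b∖a (Null-⊆ b∖a (∖⊆ B A) B-null)) q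
        (subadditive a b∖a (Measurable-∪ a b)
          (λ x x∈A h → ∖-disjoint B A x h x∈A) cover q h))
    where
    b∖a : Measurable (B ∖ A)
    b∖a = Measurable-∖ b a

    cover : (A ∪ B) ≐ (A ∪ (B ∖ A))
    cover x with A x
    ... | true  = refl
    ... | false = sym (Bool.∧-identityʳ (B x))

  -- Removing `B` from `A` costs only the null intersection and makes the two sets truly disjoint.
  measure-∪ : ∀ {A B} (a : Measurable A) (b : Measurable B) → Null (A ∩ B) →
    (measure A a +ᴿ measure B b) ≤ᴿ measure (A ∪ B) (Measurable-∪ a b)
  measure-∪ {A} {B} a b A∩B-null q h =
    superadditive a∖b b (Measurable-∪ a b) (∖-disjoint A B) cover q
      (+ᴿ-mono (measure A a) (measure (A ∖ B) a∖b) (measure B b) (measure B b)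
        a≤a∖b (λ _ lt → lt) q h)
    where
    a∖b : Measurable (A ∖ B)
    a∖b = Measurable-∖ a b

    a≤a∖b : measure A a ≤ᴿ measure (A ∖ B) a∖b
    a≤a∖b q h = x+y≤x (measure (A ∖ B) a∖b) (measure (A ∩ B) (Measurable-∩ a b))
      (Null⇒≤0 (Measurable-∩ a b) A∩B-null) q
      (subadditive a∖b (Measurable-∩ a b) a
        (λ x h k → ∖-disjoint A B x h (∩⊆ʳ A B x k)) (∖-∪-∩ A B) q h)

    cover : (A ∪ B) ≐ ((A ∖ B) ∪ B)
    cover x with A x | B x
    ... | true  | true  = refl
    ... | true  | false = refl
    ... | false | _     = refl

  measure≤1 : ∀ {A} (a : Measurable A) q → cut (measure A a) q → q < 1ℚ
  measure≤1 a q h = to (onCylinders ∅ q) (measure-mono a (cyl ∅) (λ _ _ → refl) q h)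

-- The random algebra

module RandomProperties (em : ∀ {ℓ} → ExcludedMiddle ℓ) {K : Set} (μ : ProductMeasure K) where
  open ProductMeasure μ
  open MeasureProperties μ
  open Random μ
  open Condition

  ≤ᴮ-refl : ∀ {p} → p ≤ᴮ p
  ≤ᴮ-refl {p} = ⊆⇒Null-∖ (measurable p) (measurable p) λ _ x∈p → x∈p

  ≤ᴮ-trans : ∀ {p q r} → p ≤ᴮ q → q ≤ᴮ r → p ≤ᴮ r
  ≤ᴮ-trans {p} {q} {r} p≤q q≤r =
    Null-⊆ (Measurable-∖ (measurable p) (measurable r)) cover (Null-∪ p≤q q≤r)
    where
    cover : ∀ x → (set p ∖ set r) ∋ x → ((set p ∖ set q) ∪ (set q ∖ set r)) ∋ x
    cover x h with set p x | set q x
    ... | true | true  = h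
    ... | true | false = refl

  ≤ᴮ-𝟙 : ∀ {p} → p ≤ᴮ 𝟙
  ≤ᴮ-𝟙 {p} = ⊆⇒Null-∖ (measurable p) (measurable 𝟙) λ _ _ → refl

  -- A non-null intersection would itself be a condition below both; excluded middle removes the
  -- double negation.
  incompatible⇒Null : ∀ p q → (∀ r → r ≤ᴮ p → ¬ (r ≤ᴮ q)) → Null (set p ∩ set q)
  incompatible⇒Null p q p⊥q = decidable-stable em λ p∩q-nonnull →
    let r : Condition
        r = record { set = set p ∩ set q ; measurable = p∩q ; nonzero = p∩q-nonnull }
    in p⊥q r
      (⊆⇒Null-∖ p∩q (measurable p) (∩⊆ˡ (set p) (set q)))
      (⊆⇒Null-∖ p∩q (measurable q) (∩⊆ʳ (set p) (set q)))
    where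
    p∩q : Measurable (set p ∩ set q)
    p∩q = Measurable-∩ (measurable p) (measurable q)

  positive : ∀ p → ∃[ k ] cut (measure (set p) (measurable p)) (frac 1 k)
  positive p with em {P = ∃[ q ] (0ℚ < q × cut (measure (set p) (measurable p)) q)}
  ... | yes (q , 0<q , h) =
    -- The threshold may equal `q`, while `downward` takes a strict inequality, hence the larger
    -- `r`.
    let r , q<r , h′ = open′ (measure (set p) (measurable p)) h
        k , 1/k≤q = archimedean q 0<q
    in k , downward (measure (set p) (measurable p)) (ℚ.≤-<-trans 1/k≤q q<r) h′
  ... | no ∄ = contradiction
    (≤0⇒Null (measurable p) (noPositive⇒≤0 (measure (set p) (measurable p))
      λ q 0<q h → ∄ (q , 0<q , h)))
    (nonzero p)

  open ForcingProperties Condition _≤ᴮ_ 𝟙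
    (λ {p} → ≤ᴮ-refl {p}) (λ {p q r} → ≤ᴮ-trans {p} {q} {r}) (λ {p} → ≤ᴮ-𝟙 {p})

  -- Classes of nodes and the bound on their chains

  module _ (T R : V) (tree : IsTree T R) (p : Condition) (w f : Name)
    (p⊩ω : p ⊩ isω w) (p⊩f : p ⊩ isFunction f (T ˇ) w)
    (p⊩special : p ⊩ (∀′ λ s → ∀′ λ t → s ∈′ T ˇ ∧′ t ∈′ T ˇ ∧′ related (R ˇ) s t ⇒′
      (∀′ λ m → ∀′ λ n → related f s m ∧′ related f t n ⇒′ ¬′ (m ≈′ n)))) where

    open Specializing T R p w f p⊩ω p⊩f p⊩special

    private
      infix 4 _∼_ _≺_

      _∼_ _≺_ : Index T → Index T → Set
      i ∼ j = T [ i ] ≈ T [ j ]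
      i ≺ j = ⟨ T [ i ] , T [ j ] ⟩ ∈ R

      ≺-trans : ∀ {h i j} → h ≺ i → i ≺ j → h ≺ j
      ≺-trans {h} {i} {j} h≺i i≺j = proj₂ (proj₂ (IsTree.transitive tree
        {T [ h ]} {T [ i ]} {T [ j ]}
        ([]∈ T h , []∈ T i , h≺i) ([]∈ T i , []∈ T j , i≺j)))

      ≺-resp-∼ : ∀ {g h i j} → g ∼ h → i ∼ j → g ≺ i → h ≺ j
      ≺-resp-∼ {g} {h} {i} {j} g∼h i∼j =
        ∈-respˡ ⟨ T [ g ] , T [ i ] ⟩ ⟨ T [ h ] , T [ j ] ⟩ R
          (⟨⟩-cong (T [ g ]) (T [ h ]) (T [ i ]) (T [ j ]) g∼h i∼j)

      -- `Decides` refers to the check name of one indexed representative; passing to any `j ∼ i`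
      -- makes membership independent of the index.
      Class : ℕ × ℕ → Index T → Condition → Set₁
      Class (n , k) i q = ∃[ j ] (j ∼ i × Decides j n q ×
                                  cut (measure (set q) (measurable q)) (frac 1 k))

      InClass : ℕ × ℕ → Index T → Set₁
      InClass c i = ∃[ q ] Class c i q

      InClass-resp-∼ : ∀ {c i j} → i ∼ j → InClass c i → InClass c j
      InClass-resp-∼ {_} {i} {j} i∼j (q , h , h∼i , rest) =
        q , h , ≈-trans (T [ h ]) (T [ i ]) (T [ j ]) h∼i i∼j , rest

      covered : ∀ i → ∃[ c ] InClass c i
      covered i =
        let n , q , d = decided i
            k , h = positive q
        in (n , k) , q , i , ≈-refl (T [ i ]) , d , h

      Class-disjoint : ∀ c {i j q r} → i ≺ j → Class c i q → Class c j r → Null (set q ∩ set r)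
      Class-disjoint c {i} {j} {q} {r} i≺j (g , g∼i , dq , _) (h , h∼j , dr , _) =
        incompatible⇒Null q r (decides-incompatible {g} {h}
          (≺-resp-∼ {i} {g} {j} {h}
            (≈-sym (T [ g ]) (T [ i ]) g∼i) (≈-sym (T [ h ]) (T [ j ]) h∼j) i≺j) dq dr)

      -- The union of the witnesses along the chain accumulates their measures. The last clause is
      -- the induction invariant: the next witness must be almost disjoint from the whole union, and
      -- transitivity of the tree order carries this from the earlier nodes to all later ones.
      chainUnion : ∀ n k m i → Chain _≺_ (InClass (n , k)) m i →
        ∃[ U ] Σ[ u ∈ Measurable U ]
          (cut (measure U u) (frac (suc m) k) ×
           (∀ {j r} → i ≺ j → Class (n , k) j r → Null (U ∩ set r)))
      chainUnion n k zero i (q , c@(_ , _ , _ , large)) =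
        set q , measurable q , large ,
        λ {j} {r} i≺j d → Class-disjoint (n , k) {i} {j} {q} {r} i≺j c d
      chainUnion n k (suc m) i ((q , c@(_ , _ , _ , large)) , h , h≺i , chain)
        with chainUnion n k m h chain
      ... | U , u , u-large , u-null =
        U ∪ set q , Measurable-∪ u (measurable q) ,
        measure-∪ u (measurable q) (u-null h≺i c) (frac (suc (suc m)) k)
          (subst (cut (measure U u +ᴿ measure (set q) (measurable q)))
            total (cut-+ (measure U u) (measure (set q) (measurable q)) u-large large)) ,
        λ {j} {r} i≺j d → Null-⊆
          (Measurable-∩ (Measurable-∪ u (measurable q)) (measurable r))
          (distrib r)
          (Null-∪ (u-null (≺-trans {h} {i} {j} h≺i i≺j) d)
                  (Class-disjoint (n , k) {i} {j} {q} {r} i≺j c d))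
        where
        total = trans (frac-+ (suc m) 1 k) (cong (λ a → frac (suc a) k) (ℕ.+-comm m 1))

        distrib : ∀ r x → ((U ∪ set q) ∩ set r) ∋ x → ((U ∩ set r) ∪ (set q ∩ set r)) ∋ x
        distrib r x e with U x | set q x | set r x
        ... | true  | _    | true = refl
        ... | false | true | true = refl

      short : ∀ c i → ∃[ m ] ¬ Chain _≺_ (InClass c) m i
      -- `Chain k` has k + 1 elements, so `frac (suc k) k`, which is 1, would lie in the cut of a
      -- measure whose cut has only rationals below 1.
      short (n , k) i = k , λ chain →
        let _ , u , large , _ = chainUnion n k k i chain
        in ℚ.<-irrefl (frac-1 k) (measure≤1 u (frac (suc k) k) large)

    ⊩special⇒⊨special : ⊨ special T R
    ⊩special⇒⊨special =
      let c , c-cong , c-proper = σ-boundedChains⇒colouring em _∼_ _≺_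
            (λ {i} {j} → ≈-sym (T [ i ]) (T [ j ]))
            (λ {h} {i} {j} → ≺-resp-∼ {h} {h} {i} {j} (≈-refl (T [ h ])))
            pair pair-injective InClass (λ {c} {i} {j} → InClass-resp-∼ {c} {i} {j}) covered short
      in colouring⇒special {T} {R} c c-cong c-proper

corollary3p5 : (∀ {ℓ} → ExcludedMiddle ℓ) →
    (K : Set) → ℕ ↣ K → (μ : ProductMeasure K) →
    let open Random μ in
    (T R : V) (tree : IsTree T R) → HasHeightω₁ tree → ¬ HasCofinalBranch tree →
    ¬ (⊨ special T R) → 𝟙 ⊩ ¬′ special (T ˇ) (R ˇ)
corollary3p5 em K _ μ T R tree _ _ ¬special q _ q⊩special =
  let open RandomProperties em μ
      -- The two existential quantifiers of `special` are witnessed densely: `r` fixes the name `w`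
      -- for ω, and then `p` below `r` fixes the name `f`.
      r , _ , w , r⊩ = q⊩special q (≤ᴮ-refl {q})
      p , _ , f , p⊩ω , p⊩f , p⊩proper = r⊩ r (≤ᴮ-refl {r})
  in ¬special (⊩special⇒⊨special T R tree p w f p⊩ω p⊩f p⊩proper)
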